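{- Let $u\geq 1$ and $r\geq 2$ be integers. For every non-negative integer $n$, $\alpha_u^{(r)}(n)=\beta_u^{(r)}(n)$.
   Context: A partition of $n$ is a non-increasing finite sequence of positive integers (parts) summing to $n$. $\mathcal O(n;r,1)$ denotes the set of partitions of $n$ in which exactly one distinct part value is divisible by $r$ (this part may be repeated). $\mathcal O_u(n;r,1)$ is the set of $\lambda\in\mathcal O(n;r,1)$ such that the unique part value divisible by $r$ occurs exactly $u$ times. $\mathcal D(n;r,1)$ denotes the set of partitions of $n$ in which exactly one part value occurs at least $r$ times. $\mathcal D_u(n;r,1)$ is the set of $\lambda\in\mathcal D(n;r,1)$ such that the unique part value occurring at least $r$ times equals $u$. Set $\alpha_u^{(r)}(n)=|\mathcal O_u(n;r,1)|$ and $\beta_u^{(r)}(n)=|\mathcal D_u(n;r,1)|$. -}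

module Defs where

open import Data.List.Base using (List; []; _∷_; length; filter; upTo; cartesianProductWith)
open import Data.List.Membership.Propositional using (_∈_; find; lose)
open import Data.List.Membership.Propositional.Properties using (∈-cartesianProductWith⁺; ∈-cartesianProductWith⁻; ∈-upTo⁺; ∈-filter⁺; ∈-filter⁻)
open import Data.List.Properties using (∷-injective)
open import Data.List.Relation.Unary.All using (All; []; _∷_; all?)
import Data.List.Relation.Unary.All as All
open import Data.List.Relation.Unary.Any using (here; there; Any; any?)
open import Data.List.Relation.Unary.AllPairs using ([]; _∷_)
open import Data.List.Relation.Unary.Linked using (Linked; linked?)
open import Data.List.Relation.Unary.Unique.Propositional using (Unique)
open import Data.List.Relation.Unary.Unique.Propositional.Properties using (cartesianProductWith⁺; upTo⁺; filter⁺)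
open import Data.Nat.Base using (ℕ; zero; suc; _≤_; _<_; _≥_; z≤n; s≤s)
open import Data.Nat.Divisibility using (_∣_; _∣?_)
open import Data.Nat.ListAction using (sum)
open import Data.Nat.Properties using (_≟_; _≤?_; _<?_; _≥?_; ≤-trans; m≤m+n; m≤n+m; +-mono-≤)
open import Data.Product using (Σ; ∃!; _×_; _,_; proj₁; proj₂)
open import Function.Bundles using (_⇔_; mk⇔)
open import Level using (0ℓ)
open import Relation.Binary.PropositionalEquality using (_≡_; _≢_; refl; sym; subst)
open import Relation.Nullary.Decidable using (Dec; yes; no; map′; _×-dec_; _→-dec_)
open import Relation.Unary using (Pred; Decidable)

record _PartitionOf_ (p : List ℕ) (n : ℕ) : Set where
  constructor mkPartition
  field
    nonIncreasing : Linked _≥_ p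
    positive      : All (0 <_) p
    sum≡          : sum p ≡ n

open _PartitionOf_ public

multiplicity : ℕ → List ℕ → ℕ
multiplicity v p = length (filter (v ≟_) p)

𝒪 : (n r : ℕ) → Pred (List ℕ) 0ℓ
𝒪 n r p = p PartitionOf n × ∃! _≡_ (λ v → v ∈ p × r ∣ v)

-- proj₁ e is the unique part value divisible by r.
𝒪ᵤ : (u n r : ℕ) → Pred (List ℕ) 0ℓ
𝒪ᵤ u n r p = Σ (𝒪 n r p) λ (_ , e) → multiplicity (proj₁ e) p ≡ u

𝒟 : (n r : ℕ) → Pred (List ℕ) 0ℓ
𝒟 n r p = p PartitionOf n × ∃! _≡_ (λ v → v ∈ p × r ≤ multiplicity v p)

-- proj₁ e is the unique part value occurring at least r times.
𝒟ᵤ : (u n r : ℕ) → Pred (List ℕ) 0ℓ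
𝒟ᵤ u n r p = Σ (𝒟 n r p) λ (_ , e) → proj₁ e ≡ u

partitionOf? : ∀ n → Decidable (_PartitionOf n)
partitionOf? n p =
  map′ (λ (a , b , c) → mkPartition a b c)
       (λ h → nonIncreasing h , positive h , sum≡ h)
       (linked? _≥?_ p ×-dec all? (0 <?_) p ×-dec sum p ≟ n)

∃!∈? : {P : Pred ℕ 0ℓ} → Decidable P → ∀ p → Dec (∃! _≡_ (λ v → v ∈ p × P v))
∃!∈? {P} P? p = map′ to from (any? good? p)
  where
  Good : Pred ℕ 0ℓ
  Good v = P v × All (λ w → P w → v ≡ w) p

  good? : Decidable Good
  good? v = P? v ×-dec all? (λ w → P? w →-dec v ≟ w) p

  to : Any Good p → ∃! _≡_ (λ v → v ∈ p × P v)
  to a with find a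
  ... | v , v∈p , Pv , uniq = v , (v∈p , Pv) , λ (w∈p , Pw) → All.lookup uniq w∈p Pw

  from : ∃! _≡_ (λ v → v ∈ p × P v) → Any Good p
  from (v , (v∈p , Pv) , uniq) = lose v∈p (Pv , All.tabulate (λ w∈p Pw → uniq (w∈p , Pw)))

-- Whether Q holds of "the" v with B v does not depend on the proof of unique existence.
the? : {A : Set} {B Q : Pred ℕ 0ℓ} → Decidable Q → Dec A → Dec (∃! _≡_ B) →
       Dec (Σ (A × ∃! _≡_ B) λ (_ , e) → Q (proj₁ e))
the? Q? (no ¬a) _       = no λ ((a , _) , _) → ¬a a
the? Q? (yes _) (no ¬e) = no λ ((_ , e) , _) → ¬e e
the? {Q = Q} Q? (yes a) (yes e@(v , _ , uniq)) with Q? v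
... | yes q = yes ((a , e) , q)
... | no ¬q = no λ ((_ , (_ , Bw , _)) , q) → ¬q (subst Q (sym (uniq Bw)) q)

𝒪ᵤ? : ∀ u n r → Decidable (𝒪ᵤ u n r)
𝒪ᵤ? u n r p = the? (λ v → multiplicity v p ≟ u) (partitionOf? n p) (∃!∈? (r ∣?_) p)

𝒟ᵤ? : ∀ u n r → Decidable (𝒟ᵤ u n r)
𝒟ᵤ? u n r p = the? (_≟ u) (partitionOf? n p) (∃!∈? (λ v → r ≤? multiplicity v p) p)

-- All lists of length at most k with entries in {0, …, n}, each listed once.
words : (n k : ℕ) → List (List ℕ)
words n zero    = [] ∷ []
words n (suc k) = [] ∷ cartesianProductWith _∷_ (upTo (suc n)) (words n k)

-- A partition of n has at most n parts, each at most n.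
partitions : ℕ → List (List ℕ)
partitions n = filter (partitionOf? n) (words n n)

words-complete : ∀ {n} k p → length p ≤ k → All (_≤ n) p → p ∈ words n k
words-complete zero    []      _       _          = here refl
words-complete (suc k) []      _       _          = here refl
words-complete (suc k) (x ∷ p) (s≤s l) (x≤n ∷ as) =
  there (∈-cartesianProductWith⁺ _∷_ (∈-upTo⁺ (s≤s x≤n)) (words-complete k p l as))

words-unique : ∀ n k → Unique (words n k)
words-unique n zero    = [] ∷ []
words-unique n (suc k) =
  All.tabulate []≢ ∷ cartesianProductWith⁺ _∷_ ∷-injective (upTo⁺ (suc n)) (words-unique n k)
  where
  []≢ : ∀ {q} → q ∈ cartesianProductWith _∷_ (upTo (suc n)) (words n k) → [] ≢ q
  []≢ q∈ refl with ∈-cartesianProductWith⁻ _∷_ (upTo (suc n)) (words n k) q∈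
  ... | _ , _ , _ , _ , ()

length≤sum : ∀ {p} → All (0 <_) p → length p ≤ sum p
length≤sum []       = z≤n
length≤sum (h ∷ hs) = +-mono-≤ h (length≤sum hs)

parts≤sum : ∀ p → All (_≤ sum p) p
parts≤sum []      = []
parts≤sum (x ∷ p) = m≤m+n x (sum p) ∷ All.map (λ h → ≤-trans h (m≤n+m (sum p) x)) (parts≤sum p)

∈-partitions : ∀ n p → p ∈ partitions n ⇔ p PartitionOf n
∈-partitions n p = mk⇔ (λ h → proj₂ (∈-filter⁻ (partitionOf? n) {xs = words n n} h)) from
  where
  from : p PartitionOf n → p ∈ partitions n
  from h@(mkPartition _ pos refl) =
    ∈-filter⁺ (partitionOf? n) (words-complete n p (length≤sum pos) (parts≤sum p)) h

partitions-unique : ∀ n → Unique (partitions n)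
partitions-unique n = filter⁺ (partitionOf? n) (words-unique n n)

-- By ∈-partitions and partitions-unique, these are the cardinalities of 𝒪ᵤ u n r and 𝒟ᵤ u n r.
α : (u r n : ℕ) → ℕ
α u r n = length (filter (𝒪ᵤ? u n r) (partitions n))

β : (u r n : ℕ) → ℕ
β u r n = length (filter (𝒟ᵤ? u n r) (partitions n))

{-# OPTIONS --safe #-}
-- Glaisher's bijection, with one marked part.  Let p ∈ 𝒪ᵤ have j * r as its unique part value
-- divisible by r, occurring u times.  Let t k be the multiplicity of k in p for r ∤ k, and extend
-- t by t (k * r) = t k / r: this is the number of parts k seen when r equal parts are merged
-- into one as long as possible, and t k % r of them are never merged further.  The partition q
-- with t k % r parts k, together with j * r additional parts u, lies in 𝒟ᵤ, and the sums agree
-- because u parts j * r and j * r parts u weigh the same.  Conversely q determines j as the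
-- quotient by r of the multiplicity of u, and t by the base-r expansion
-- t k = t k % r + t (k * r) * r, which stops since t vanishes beyond n.
module Submission where

open import Defs
open import Data.List.Base using (List; []; _∷_; _++_; length; filter; replicate)
open import Data.List.Membership.Propositional using (_∈_)
open import Data.List.Membership.Propositional.Properties using (∈-∃++; ∈-++⁻; ∈-++⁺ˡ; ∈-++⁺ʳ; ∈-filter⁺; ∈-filter⁻; ∈-length)
open import Data.List.Properties using (length-++; filter-++; filter-accept; filter-reject)
open import Data.List.Relation.Unary.All using (All; []; _∷_)
import Data.List.Relation.Unary.All as All
import Data.List.Relation.Unary.All.Properties as All
open import Data.List.Relation.Unary.AllPairs using ([]; _∷_)
open import Data.List.Relation.Unary.Any using (here; there)
open import Data.List.Relation.Unary.Linked using (Linked; []; [-]; _∷_)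
import Data.List.Relation.Unary.Linked as Linked
open import Data.List.Relation.Unary.Linked.Properties using (Linked⇒All)
open import Data.List.Relation.Unary.Unique.Propositional using (Unique)
import Data.List.Relation.Unary.Unique.Propositional.Properties as Unique
open import Data.Nat.Base using (ℕ; zero; suc; _+_; _*_; _≤_; _<_; _≥_; z≤n; s≤s; NonZero; >-nonZero)
open import Data.Nat.Divisibility using (_∣_; _∤_; _∣?_; divides; n∣m*n; _∣0)
open import Data.Nat.DivMod using (_/_; _%_; m≡m%n+[m/n]*n; m%n<n; m<n⇒m%n≡m; m<n⇒m/n≡0; m*n/n≡m; 0/n≡0; m/n*n≤m; m≥n⇒m/n>0; +-distrib-/-∣ʳ; [m+kn]%n≡m%n; m%n%n≡m%n)
open import Data.Nat.Induction using (<-rec; <-wellFounded)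
open import Data.Nat.ListAction using (sum)
open import Data.Nat.ListAction.Properties using (sum-++)
open import Data.Nat.Properties
open import Data.Nat.Tactic.RingSolver using (solve-∀)
open import Data.Product using (∃; _×_; _,_; proj₂)
open import Data.Sum.Base using (inj₁; inj₂; [_,_]′)
open import Function.Base using (flip)
open import Function.Bundles using (Equivalence)
import Induction.WellFounded as WellFounded
open import Relation.Binary.PropositionalEquality using (_≡_; _≢_; refl; sym; trans; cong; cong₂; subst; module ≡-Reasoning)
open import Relation.Nullary.Decidable using (Dec; yes; no; toSum)
open import Relation.Nullary.Negation using (¬_; contradiction)

-- Counting along a relation

-- Induction that deletes the partner `y` of the head from `ys`: by `inj` no later element of `xs`
-- can be matched to `y` itself, so all the others keep their partners.
length-≤-via : ∀ {A B : Set} (R : A → B → Set) → (∀ {x x′ y} → R x y → R x′ y → x ≡ x′) →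
               ∀ {xs} ys → Unique xs → (∀ {x} → x ∈ xs → ∃ λ y → y ∈ ys × R x y) →
               length xs ≤ length ys
length-≤-via R inj {[]}     ys _            _ = z≤n
length-≤-via R inj {x ∷ xs} ys (x∉ ∷ uniq) f
  with y , y∈ , Rxy ← f (here refl)
  with as , bs , refl ← ∈-∃++ y∈ = begin
    suc (length xs)             ≤⟨ s≤s (length-≤-via R inj (as ++ bs) uniq g) ⟩
    suc (length (as ++ bs))     ≡⟨ cong suc (length-++ as) ⟩
    suc (length as + length bs) ≡⟨ +-suc (length as) (length bs) ⟨
    length as + suc (length bs) ≡⟨ length-++ as ⟨
    length (as ++ y ∷ bs)       ∎
  where
  open ≤-Reasoning
  g : ∀ {x′} → x′ ∈ xs → ∃ λ y′ → y′ ∈ as ++ bs × R x′ y′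
  g x′∈ with y′ , y′∈ , Rx′y′ ← f (there x′∈) with ∈-++⁻ as y′∈
  ... | inj₁ y′∈as          = y′ , ∈-++⁺ˡ y′∈as , Rx′y′
  ... | inj₂ (here refl)    = contradiction (inj Rxy Rx′y′) (All.lookup x∉ x′∈)
  ... | inj₂ (there y′∈bs)  = y′ , ∈-++⁺ʳ as y′∈bs , Rx′y′

-- Restriction to a decidable condition, and sums over 1, …, n

when : {P : Set} → Dec P → ℕ → ℕ
when (yes _) x = x
when (no _)  x = 0

unless : {P : Set} → Dec P → ℕ → ℕ
unless (yes _) x = 0
unless (no _)  x = x

when-yes : {P : Set} (d : Dec P) {x : ℕ} → P → when d x ≡ x
when-yes (yes _) _ = refl
when-yes (no ¬p) p = contradiction p ¬p

when-no : {P : Set} (d : Dec P) {x : ℕ} → ¬ P → when d x ≡ 0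
when-no (yes p) ¬p = contradiction p ¬p
when-no (no _)  _  = refl

unless-yes : {P : Set} (d : Dec P) {x : ℕ} → P → unless d x ≡ 0
unless-yes (yes _) _ = refl
unless-yes (no ¬p) p = contradiction p ¬p

unless-no : {P : Set} (d : Dec P) {x : ℕ} → ¬ P → unless d x ≡ x
unless-no (yes p) ¬p = contradiction p ¬p
unless-no (no _)  _  = refl

when-zero : {P : Set} (d : Dec P) → when d 0 ≡ 0
when-zero (yes _) = refl
when-zero (no _)  = refl

unless-zero : {P : Set} (d : Dec P) → unless d 0 ≡ 0
unless-zero (yes _) = refl
unless-zero (no _)  = refl

unless+when : {P : Set} (d : Dec P) (x : ℕ) → unless d x + when d x ≡ x
unless+when (yes _) x = refl
unless+when (no _)  x = +-identityʳ x

*-when : {P : Set} (d : Dec P) (k x : ℕ) → k * when d x ≡ when d (k * x)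
*-when (yes _) k x = refl
*-when (no _)  k x = *-zeroʳ k

∑ : ℕ → (ℕ → ℕ) → ℕ
∑ zero    f = 0
∑ (suc n) f = f (suc n) + ∑ n f

∑-cong : ∀ n {f g} → (∀ {k} → 1 ≤ k → k ≤ n → f k ≡ g k) → ∑ n f ≡ ∑ n g
∑-cong zero    h = refl
∑-cong (suc n) h = cong₂ _+_ (h (s≤s z≤n) ≤-refl) (∑-cong n λ 1≤k k≤n → h 1≤k (m≤n⇒m≤1+n k≤n))

∑-zero : ∀ n {f} → (∀ {k} → 1 ≤ k → k ≤ n → f k ≡ 0) → ∑ n f ≡ 0
∑-zero zero    h = refl
∑-zero (suc n) h = cong₂ _+_ (h (s≤s z≤n) ≤-refl) (∑-zero n λ 1≤k k≤n → h 1≤k (m≤n⇒m≤1+n k≤n))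

∑-+ : ∀ n f g → ∑ n (λ k → f k + g k) ≡ ∑ n f + ∑ n g
∑-+ zero    f g = refl
∑-+ (suc n) f g = trans (cong (f (suc n) + g (suc n) +_) (∑-+ n f g))
                        (interchange (f (suc n)) (g (suc n)) (∑ n f) (∑ n g))
  where
  interchange : ∀ a b c d → a + b + (c + d) ≡ a + c + (b + d)
  interchange = solve-∀

∑-comm : ∀ m n (f : ℕ → ℕ → ℕ) → ∑ m (λ i → ∑ n (f i)) ≡ ∑ n (λ k → ∑ m (λ i → f i k))
∑-comm zero    n f = sym (∑-zero n λ _ _ → refl)
∑-comm (suc m) n f = trans (cong (∑ n (f (suc m)) +_) (∑-comm m n f)) (sym (∑-+ n _ _))

-- Only the term at `a` survives. If `a` lies beyond `n` the sum is empty of such terms, and `out`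
-- makes the right-hand side vanish as well.
∑-when : ∀ n {P : ℕ → Set} (P? : ∀ k → Dec (P k)) (f : ℕ → ℕ) {a} → 1 ≤ a → P a →
         (∀ {k} → P k → k ≡ a) → (n < a → f a ≡ 0) → ∑ n (λ k → when (P? k) (f k)) ≡ f a
∑-when zero    P? f 1≤a Pa P⇒ out = sym (out 1≤a)
∑-when (suc n) P? f {a} 1≤a Pa P⇒ out with P? (suc n)
... | yes P1+n with refl ← P⇒ P1+n =
  trans (cong (f (suc n) +_) (∑-zero n λ {k} _ k≤n → when-no (P? k) λ Pk → <⇒≢ (s≤s k≤n) (P⇒ Pk)))
        (+-identityʳ _)
-- Since `P` fails at `suc n`, the bound `n < a` sharpens to `suc n < a`, which is what `out`
-- demands.
... | no ¬P1+n = ∑-when n P? f 1≤a Pa P⇒ λ n<a → out (≤∧≢⇒< n<a λ { refl → ¬P1+n Pa })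

-- Reindexing by double counting: a multiple `k` of `r` is `i * r` for exactly one `i`, so the
-- condition becomes a sum over `i` and the two sums are exchanged. On the right `i * r` may exceed
-- `n`; there `vanish` applies.
∑-multiples : ∀ r .{{_ : NonZero r}} n (f : ℕ → ℕ) → (∀ {k} → n < k → f k ≡ 0) →
              ∑ n (λ k → when (r ∣? k) (f k)) ≡ ∑ n (λ i → f (i * r))
∑-multiples r n f vanish = begin
  ∑ n (λ k → when (r ∣? k) (f k))                 ≡⟨ ∑-cong n expand ⟩
  ∑ n (λ k → ∑ n (λ i → when (k ≟ i * r) (f k)))  ≡⟨ ∑-comm n n _ ⟩
  ∑ n (λ i → ∑ n (λ k → when (k ≟ i * r) (f k)))  ≡⟨ ∑-cong n collapse ⟩
  ∑ n (λ i → f (i * r))                           ∎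
  where
  open ≡-Reasoning
  expand : ∀ {k} → 1 ≤ k → k ≤ n → when (r ∣? k) (f k) ≡ ∑ n (λ i → when (k ≟ i * r) (f k))
  expand {k} 1≤k k≤n with r ∣? k
  ... | no r∤k = sym (∑-zero n λ {i} _ _ → when-no (k ≟ i * r) λ k≡ → r∤k (divides i k≡))
  ... | yes (divides q refl) = sym (∑-when n (λ i → q * r ≟ i * r) (λ _ → f (q * r)) 1≤q refl
          (λ {i} eq → sym (*-cancelʳ-≡ q i r eq))
          λ n<q → contradiction (≤-trans (m≤m*n q r) k≤n) (<⇒≱ n<q))
    where
    1≤q : 1 ≤ q
    1≤q = n≢0⇒n>0 λ { refl → contradiction 1≤k λ () }
  collapse : ∀ {i} → 1 ≤ i → i ≤ n → ∑ n (λ k → when (k ≟ i * r) (f k)) ≡ f (i * r)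
  collapse {i} 1≤i _ = ∑-when n (_≟ i * r) f (≤-trans 1≤i (m≤m*n i r)) refl (λ eq → eq) vanish

-- Partitions and their multiplicities

multiplicity-here : ∀ v p → multiplicity v (v ∷ p) ≡ suc (multiplicity v p)
multiplicity-here v p = cong length (filter-accept (v ≟_) refl)

multiplicity-there : ∀ {v x} p → v ≢ x → multiplicity v (x ∷ p) ≡ multiplicity v p
multiplicity-there {v} p v≢x = cong length (filter-reject (v ≟_) v≢x)

multiplicity-++ : ∀ v p q → multiplicity v (p ++ q) ≡ multiplicity v p + multiplicity v q
multiplicity-++ v p q = trans (cong length (filter-++ (v ≟_) p q)) (length-++ (filter (v ≟_) p))

multiplicity-replicate : ∀ v c x → multiplicity v (replicate c x) ≡ when (v ≟ x) c
multiplicity-replicate v zero    x = sym (when-zero (v ≟ x))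
multiplicity-replicate v (suc c) x with v ≟ x | multiplicity-replicate v c x
... | yes refl | ih = trans (multiplicity-here v (replicate c v)) (cong suc ih)
... | no v≢x   | ih = trans (multiplicity-there (replicate c x) v≢x) ih

∈⇒multiplicity>0 : ∀ {v p} → v ∈ p → 0 < multiplicity v p
∈⇒multiplicity>0 {v} v∈p = ∈-length (∈-filter⁺ (v ≟_) v∈p refl)

multiplicity>0⇒∈ : ∀ {v} p → 0 < multiplicity v p → v ∈ p
multiplicity>0⇒∈ {v} (x ∷ p) h with v ≟ x
... | yes refl = here refl
... | no v≢x   = there (multiplicity>0⇒∈ p (subst (0 <_) (multiplicity-there p v≢x) h))

multiplicity*≤sum : ∀ v p → v * multiplicity v p ≤ sum p
multiplicity*≤sum v []      = ≤-reflexive (*-zeroʳ v)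
multiplicity*≤sum v (x ∷ p) with v ≟ x
... | yes refl = begin
  v * multiplicity v (v ∷ p)   ≡⟨ cong (v *_) (multiplicity-here v p) ⟩
  v * suc (multiplicity v p)   ≡⟨ *-suc v _ ⟩
  v + v * multiplicity v p     ≤⟨ +-monoʳ-≤ v (multiplicity*≤sum v p) ⟩
  v + sum p                    ∎
  where open ≤-Reasoning
... | no v≢x = begin
  v * multiplicity v (x ∷ p)   ≡⟨ cong (v *_) (multiplicity-there p v≢x) ⟩
  v * multiplicity v p         ≤⟨ multiplicity*≤sum v p ⟩
  sum p                        ≤⟨ m≤n+m (sum p) x ⟩
  x + sum p                    ∎
  where open ≤-Reasoning

multiplicity-bound : ∀ {n p} v → p PartitionOf n → v * multiplicity v p ≤ n
multiplicity-bound {p = p} v h = subst (v * multiplicity v p ≤_) (sum≡ h) (multiplicity*≤sum v p)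

multiplicity-zero : ∀ {n p} → p PartitionOf n → multiplicity 0 p ≡ 0
multiplicity-zero {p = p} h with multiplicity 0 p in eq
... | zero  = refl
... | suc _ = contradiction
  (All.lookup (positive h) (multiplicity>0⇒∈ p (subst (0 <_) (sym eq) (s≤s z≤n)))) λ ()

multiplicity-large : ∀ {n p k} → p PartitionOf n → n < k → multiplicity k p ≡ 0
multiplicity-large {n} {p} {k} h n<k with multiplicity k p | multiplicity-bound k h
... | zero  | _ = refl
... | suc c | b = contradiction (≤-trans (m≤m*n k (suc c)) b) (<⇒≱ n<k)

∈⇒≤head : ∀ {v x p} → Linked _≥_ (x ∷ p) → v ∈ x ∷ p → v ≤ x
∈⇒≤head l = All.lookup (Linked⇒All (flip ≤-trans) ≤-refl l)

-- The head is the maximum of a non-increasing list, and each head occurs in the other list, so the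
-- heads agree by antisymmetry; their contribution then cancels.
multiplicity-injective : ∀ {p q} → Linked _≥_ p → Linked _≥_ q →
                         (∀ v → multiplicity v p ≡ multiplicity v q) → p ≡ q
multiplicity-injective {[]}    {[]}    _  _  _  = refl
multiplicity-injective {[]}    {y ∷ q} _  _  eq = contradiction (trans (eq y) (multiplicity-here y q)) λ ()
multiplicity-injective {x ∷ p} {[]}    _  _  eq = contradiction (trans (sym (multiplicity-here x p)) (eq x)) λ ()
multiplicity-injective {x ∷ p} {y ∷ q} lp lq eq
  with refl ← ≤-antisym
         (∈⇒≤head lq (multiplicity>0⇒∈ (y ∷ q) (subst (0 <_) (eq x) (∈⇒multiplicity>0 {x} {x ∷ p} (here refl)))))
         (∈⇒≤head lp (multiplicity>0⇒∈ (x ∷ p) (subst (0 <_) (sym (eq y)) (∈⇒multiplicity>0 {y} {y ∷ q} (here refl)))))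
  = cong (x ∷_) (multiplicity-injective (Linked.tail lp) (Linked.tail lq) tails)
  where
  tails : ∀ v → multiplicity v p ≡ multiplicity v q
  tails v = +-cancelˡ-≡ (multiplicity v (x ∷ [])) _ _
    (trans (sym (multiplicity-++ v (x ∷ []) p)) (trans (eq v) (multiplicity-++ v (x ∷ []) q)))

fromMultiplicity : ℕ → (ℕ → ℕ) → List ℕ
fromMultiplicity zero    m = []
fromMultiplicity (suc n) m = replicate (m (suc n)) (suc n) ++ fromMultiplicity n m

fromMultiplicity-≤ : ∀ n m → All (_≤ n) (fromMultiplicity n m)
fromMultiplicity-≤ zero    m = []
fromMultiplicity-≤ (suc n) m =
  All.++⁺ (All.replicate⁺ (m (suc n)) ≤-refl) (All.map m≤n⇒m≤1+n (fromMultiplicity-≤ n m))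

fromMultiplicity-positive : ∀ n m → All (0 <_) (fromMultiplicity n m)
fromMultiplicity-positive zero    m = []
fromMultiplicity-positive (suc n) m =
  All.++⁺ (All.replicate⁺ (m (suc n)) (s≤s z≤n)) (fromMultiplicity-positive n m)

replicate-++-nonIncreasing : ∀ c {x p} → All (_≤ x) p → Linked _≥_ p → Linked _≥_ (replicate c x ++ p)
replicate-++-nonIncreasing zero          _         l = l
replicate-++-nonIncreasing (suc zero)    []        l = [-]
replicate-++-nonIncreasing (suc zero)    (y≤x ∷ _) l = y≤x ∷ l
replicate-++-nonIncreasing (suc (suc c)) p≤x       l = ≤-refl ∷ replicate-++-nonIncreasing (suc c) p≤x l

fromMultiplicity-nonIncreasing : ∀ n m → Linked _≥_ (fromMultiplicity n m)
fromMultiplicity-nonIncreasing zero    m = []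
fromMultiplicity-nonIncreasing (suc n) m =
  replicate-++-nonIncreasing (m (suc n)) (All.map m≤n⇒m≤1+n (fromMultiplicity-≤ n m))
    (fromMultiplicity-nonIncreasing n m)

sum-replicate : ∀ c x → sum (replicate c x) ≡ x * c
sum-replicate zero    x = sym (*-zeroʳ x)
sum-replicate (suc c) x = trans (cong (x +_) (sum-replicate c x)) (sym (*-suc x c))

sum-fromMultiplicity : ∀ n m → sum (fromMultiplicity n m) ≡ ∑ n (λ k → k * m k)
sum-fromMultiplicity zero    m = refl
sum-fromMultiplicity (suc n) m =
  trans (sum-++ (replicate (m (suc n)) (suc n)) (fromMultiplicity n m))
        (cong₂ _+_ (sum-replicate (m (suc n)) (suc n)) (sum-fromMultiplicity n m))

multiplicity-fromMultiplicity-> : ∀ n m {k} → n < k → multiplicity k (fromMultiplicity n m) ≡ 0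
multiplicity-fromMultiplicity-> zero    m     _   = refl
multiplicity-fromMultiplicity-> (suc n) m {k} n<k =
  trans (multiplicity-++ k (replicate (m (suc n)) (suc n)) _)
    (cong₂ _+_ (trans (multiplicity-replicate k (m (suc n)) (suc n)) (when-no (k ≟ suc n) (>⇒≢ n<k)))
               (multiplicity-fromMultiplicity-> n m (<⇒≤ n<k)))

multiplicity-fromMultiplicity-≤ : ∀ n m {k} → 1 ≤ k → k ≤ n → multiplicity k (fromMultiplicity n m) ≡ m k
multiplicity-fromMultiplicity-≤ zero    m     (s≤s _) ()
multiplicity-fromMultiplicity-≤ (suc n) m {k} 1≤k k≤1+n =
  trans (multiplicity-++ k (replicate (m (suc n)) (suc n)) _)
    (trans (cong (_+ multiplicity k (fromMultiplicity n m)) (multiplicity-replicate k (m (suc n)) (suc n)))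
           rest)
  where
  rest : when (k ≟ suc n) (m (suc n)) + multiplicity k (fromMultiplicity n m) ≡ m k
  rest with k ≟ suc n
  ... | yes refl = trans (cong (m k +_) (multiplicity-fromMultiplicity-> n m ≤-refl)) (+-identityʳ _)
  ... | no k≢1+n = multiplicity-fromMultiplicity-≤ n m 1≤k (m<1+n⇒m≤n (≤∧≢⇒< k≤1+n k≢1+n))

multiplicity-fromMultiplicity : ∀ n m → m 0 ≡ 0 → (∀ {k} → n < k → m k ≡ 0) →
                                ∀ k → multiplicity k (fromMultiplicity n m) ≡ m k
multiplicity-fromMultiplicity n m m0≡0 vanish k with k ≤? n
... | no k≰n = trans (multiplicity-fromMultiplicity-> n m (≰⇒> k≰n)) (sym (vanish (≰⇒> k≰n)))
multiplicity-fromMultiplicity n m m0≡0 vanish zero    | yes _   =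
  -- The list is a partition of its own sum, which suffices to exclude 0 as a part.
  trans (multiplicity-zero (mkPartition (fromMultiplicity-nonIncreasing n m) (fromMultiplicity-positive n m) refl))
        (sym m0≡0)
multiplicity-fromMultiplicity n m m0≡0 vanish (suc k) | yes k<n = multiplicity-fromMultiplicity-≤ n m (s≤s z≤n) k<n

-- A partition equals the list rebuilt from its multiplicities, for which the weighted sum is known.
sum-via-multiplicity : ∀ {n p} → p PartitionOf n → ∑ n (λ k → k * multiplicity k p) ≡ n
sum-via-multiplicity {n} {p} h = begin
  ∑ n (λ k → k * multiplicity k p)                  ≡⟨ sum-fromMultiplicity n (flip multiplicity p) ⟨
  sum (fromMultiplicity n (flip multiplicity p))    ≡⟨ cong sum (multiplicity-injective
    (fromMultiplicity-nonIncreasing n _) (nonIncreasing h)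
    (multiplicity-fromMultiplicity n (flip multiplicity p) (multiplicity-zero h) (multiplicity-large h))) ⟩
  sum p                                             ≡⟨ sum≡ h ⟩
  n                                                 ∎
  where open ≡-Reasoning

-- Glaisher's correspondence

module _ (u r n : ℕ) (u≥1 : u ≥ 1) (r≥2 : r ≥ 2) where

  private instance
    r≢0 : NonZero r
    r≢0 = >-nonZero (<⇒≤ r≥2)

  -- In the two multiplicity functions the marked block swaps roles: `u` parts `j * r` against
  -- `j * r` parts `u`. Otherwise the first reads `t` only where `r ∤ k`, the second only its last
  -- base-`r` digit.
  𝒪-multiplicity : (t : ℕ → ℕ) (j k : ℕ) → ℕ
  𝒪-multiplicity t j k = unless (r ∣? k) (t k) + when (k ≟ j * r) u

  𝒟-multiplicity : (t : ℕ → ℕ) (j k : ℕ) → ℕ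
  𝒟-multiplicity t j k = t k % r + when (k ≟ u) (j * r)

  -- For `k` positive, the remainders of `t` along `k`, `k * r`, `k * r * r`, ... are the base-`r`
  -- digits of `t k`; `t-large` ends the expansion.
  record Merging (t : ℕ → ℕ) : Set where
    field
      t-zero  : t 0 ≡ 0
      t-large : ∀ {k} → n < k → t k ≡ 0
      t-*     : ∀ k → t (k * r) ≡ t k / r

    t-digit : ∀ k → t k ≡ t k % r + t (k * r) * r
    t-digit k = trans (m≡m%n+[m/n]*n (t k) r) (cong (λ x → t k % r + x * r) (sym (t-* k)))

  -- The bijection as a relation: both partitions are described by the same `t` and `j`, so the two
  -- directions can be treated alike.
  record Matched (p q : List ℕ) : Set where
    field
      t        : ℕ → ℕ
      j        : ℕ
      merging  : Merging t
      p-parts  : p PartitionOf n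
      q-parts  : q PartitionOf n
      p-mult   : ∀ k → multiplicity k p ≡ 𝒪-multiplicity t j k
      q-mult   : ∀ k → multiplicity k q ≡ 𝒟-multiplicity t j k
    open Merging merging public

    u-mult : multiplicity u q ≡ t u % r + j * r
    u-mult = trans (q-mult u) (cong (t u % r +_) (when-yes (u ≟ u) refl))

    -- The additional parts `u` number a multiple of `r`, so the digit of `t` can be read off even
    -- at `u`.
    q-mult% : ∀ k → multiplicity k q % r ≡ t k % r
    q-mult% k = trans (cong (_% r) (q-mult k)) (digit (k ≟ u))
      where
      digit : (d : Dec (k ≡ u)) → (t k % r + when d (j * r)) % r ≡ t k % r
      digit (yes _) = trans ([m+kn]%n≡m%n (t k % r) j r) (m%n%n≡m%n (t k) r)
      digit (no _)  = trans (cong (_% r) (+-identityʳ (t k % r))) (m%n%n≡m%n (t k) r)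

  -- Uniqueness of partners

  digit-/ : ∀ s q → s < r → (s + q * r) / r ≡ q
  digit-/ s q s<r = trans (+-distrib-/-∣ʳ s (n∣m*n q)) (cong₂ _+_ (m<n⇒m/n≡0 s<r) (m*n/n≡m q r))

  digit-% : ∀ s q → s < r → (s + q * r) % r ≡ s
  digit-% s q s<r = trans ([m+kn]%n≡m%n s q r) (m<n⇒m%n≡m s<r)

  <-* : ∀ {k} → 1 ≤ k → k < k * r
  <-* {k} 1≤k = m<m*n k r {{>-nonZero 1≤k}} r≥2

  Matched-injective : ∀ {p p′ q} → Matched p q → Matched p′ q → p ≡ p′
  Matched-injective {p} {p′} {q} M M′ =
    multiplicity-injective (nonIncreasing M.p-parts) (nonIncreasing M′.p-parts) λ k →
      trans (M.p-mult k) (trans (cong₂ (λ x i → unless (r ∣? k) x + when (k ≟ i * r) u) (t≡ k) j≡)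
        (sym (M′.p-mult k)))
    where
    module M = Matched M
    module M′ = Matched M′
    j-from : ∀ {p} (M : Matched p q) → multiplicity u q / r ≡ Matched.j M
    j-from M = trans (cong (_/ r) (Matched.u-mult M)) (digit-/ _ (Matched.j M) (m%n<n _ r))
    j≡ : M.j ≡ M′.j
    j≡ = trans (sym (j-from M)) (j-from M′)
    -- Induction from large `k` downwards. Since `k < k * r`, passing to `k * r` costs at most one
    -- unit of `f`.
    t≡′ : ∀ f k → 1 ≤ k → n < k + f → M.t k ≡ M′.t k
    t≡′ zero    k _   n<k = trans (M.t-large n<k′) (sym (M′.t-large n<k′))
      where n<k′ = subst (n <_) (+-identityʳ k) n<k
    t≡′ (suc f) k 1≤k n<k+f = begin
      M.t k                              ≡⟨ M.t-digit k ⟩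
      M.t k % r + M.t (k * r) * r        ≡⟨ cong₂ (λ x y → x + y * r) (trans (sym (M.q-mult% k)) (M′.q-mult% k))
                                              (t≡′ f (k * r) (≤-trans 1≤k (m≤m*n k r)) bound) ⟩
      M′.t k % r + M′.t (k * r) * r      ≡⟨ M′.t-digit k ⟨
      M′.t k                             ∎
      where
      open ≡-Reasoning
      bound : n < k * r + f
      bound = ≤-trans n<k+f (≤-trans (≤-reflexive (+-suc k f)) (+-monoˡ-≤ f (<-* 1≤k)))
    t≡ : ∀ k → M.t k ≡ M′.t k
    -- Multiplication by `r` fixes 0, so the downward induction cannot start there.
    t≡ zero    = trans M.t-zero (sym M′.t-zero)
    t≡ (suc k) = t≡′ n (suc k) (s≤s z≤n) (s≤s (m≤n+m n k))

  -- The marked value is the only multiple of `r` in `p`. Strong induction recovers `t`: from `p`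
  -- where `r ∤ k`, and as a quotient of an earlier value otherwise.
  Matched-functional : ∀ {p q q′} → Matched p q → Matched p q′ → q ≡ q′
  Matched-functional {p} {q} {q′} M M′ =
    multiplicity-injective (nonIncreasing M.q-parts) (nonIncreasing M′.q-parts) λ k →
      trans (M.q-mult k) (trans (cong₂ (λ x y → x % r + when (k ≟ u) y) (t≡ k) jr≡)
        (sym (M′.q-mult k)))
    where
    module M = Matched M
    module M′ = Matched M′
    jr≡ : M.j * r ≡ M′.j * r
    jr≡ with M.j * r ≟ M′.j * r
    ... | yes eq = eq
    -- Otherwise `M.j * r` would occur in `p` both `u` times and not at all.
    ... | no neq = contradiction u≡0 (>⇒≢ u≥1)
      where
      open ≡-Reasoning
      u≡0 : u ≡ 0
      u≡0 = begin
        u                                ≡⟨ cong₂ _+_ (unless-yes (r ∣? M.j * r) (n∣m*n M.j)) (when-yes (M.j * r ≟ M.j * r) refl) ⟨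
        𝒪-multiplicity M.t M.j (M.j * r)   ≡⟨ M.p-mult (M.j * r) ⟨
        multiplicity (M.j * r) p         ≡⟨ M′.p-mult (M.j * r) ⟩
        𝒪-multiplicity M′.t M′.j (M.j * r) ≡⟨ cong₂ _+_ (unless-yes (r ∣? M.j * r) (n∣m*n M.j)) (when-no (M.j * r ≟ M′.j * r) neq) ⟩
        0                                ∎
    t≡ : ∀ k → M.t k ≡ M′.t k
    t≡ = <-rec _ step
      where
      step : ∀ k → (∀ {i} → i < k → M.t i ≡ M′.t i) → M.t k ≡ M′.t k
      step zero      _  = trans M.t-zero (sym M′.t-zero)
      step k@(suc _) ih with r ∣? k
      ... | yes (divides i k≡ir) = begin
        M.t k         ≡⟨ cong M.t k≡ir ⟩
        M.t (i * r)   ≡⟨ M.t-* i ⟩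
        M.t i / r     ≡⟨ cong (_/ r) (ih (subst (i <_) (sym k≡ir) (<-* (n≢0⇒n>0 λ { refl → contradiction k≡ir λ () })))) ⟩
        M′.t i / r    ≡⟨ M′.t-* i ⟨
        M′.t (i * r)  ≡⟨ cong M′.t k≡ir ⟨
        M′.t k        ∎
        where open ≡-Reasoning
      ... | no r∤k = begin
        M.t k                    ≡⟨ regular M ⟨
        multiplicity k p         ≡⟨ regular M′ ⟩
        M′.t k                   ∎
        where
        open ≡-Reasoning
        regular : ∀ {q} (M : Matched p q) → multiplicity k p ≡ Matched.t M k
        regular M = trans (Matched.p-mult M k) (trans (cong₂ _+_ (unless-no (r ∣? k) r∤k)
          (when-no (k ≟ j * r) λ k≡ → r∤k (divides j k≡))) (+-identityʳ _))
          where open Matched M using (j)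

  -- Preservation of the sum

  𝒪-sum≡𝒟-sum : ∀ {t j} → Merging t → 1 ≤ j → j * r ≤ n → u ≤ n →
                ∑ n (λ k → k * 𝒪-multiplicity t j k) ≡ ∑ n (λ k → k * 𝒟-multiplicity t j k)
  𝒪-sum≡𝒟-sum {t} {j} merging 1≤j jr≤n u≤n = begin
    -- The marked block is split off; its part value must lie between 1 and `n` to be met by the
    -- sum.
    ∑ n (λ k → k * 𝒪-multiplicity t j k)                   ≡⟨ split (λ k → unless (r ∣? k) (t k)) (≤-trans 1≤j (m≤m*n j r)) jr≤n ⟩
    ∑ n (λ k → k * unless (r ∣? k) (t k)) + j * r * u      ≡⟨ cong₂ _+_ unmarked (*-comm (j * r) u) ⟩
    ∑ n (λ k → k * (t k % r)) + u * (j * r)                ≡⟨ split (λ k → t k % r) u≥1 u≤n ⟨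
    ∑ n (λ k → k * 𝒟-multiplicity t j k)                   ∎
    where
    open ≡-Reasoning
    open Merging merging

    split : ∀ f {a c} → 1 ≤ a → a ≤ n → ∑ n (λ k → k * (f k + when (k ≟ a) c)) ≡ ∑ n (λ k → k * f k) + a * c
    split f {a} {c} 1≤a a≤n = begin
      ∑ n (λ k → k * (f k + when (k ≟ a) c))                       ≡⟨ ∑-cong n (λ {k} _ _ →
        trans (*-distribˡ-+ k (f k) _) (cong (k * f k +_) (*-when (k ≟ a) k c))) ⟩
      ∑ n (λ k → k * f k + when (k ≟ a) (k * c))                   ≡⟨ ∑-+ n _ _ ⟩
      ∑ n (λ k → k * f k) + ∑ n (λ k → when (k ≟ a) (k * c))       ≡⟨ cong (∑ n (λ k → k * f k) +_)
        (∑-when n (_≟ a) (_* c) 1≤a refl (λ eq → eq) λ n<a → contradiction a≤n (<⇒≱ n<a)) ⟩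
      ∑ n (λ k → k * f k) + a * c                                  ∎

    -- Undoing one merge keeps the weight: `t (k * r)` parts `k * r` weigh as much as
    -- `t (k * r) * r` parts `k`.
    multiples : ∑ n (λ k → k * when (r ∣? k) (t k)) ≡ ∑ n (λ k → k * (t (k * r) * r))
    multiples = begin
      ∑ n (λ k → k * when (r ∣? k) (t k))    ≡⟨ ∑-cong n (λ {k} _ _ → *-when (r ∣? k) k (t k)) ⟩
      ∑ n (λ k → when (r ∣? k) (k * t k))    ≡⟨ ∑-multiples r n (λ k → k * t k)
                                                  (λ {k} n<k → trans (cong (k *_) (t-large n<k)) (*-zeroʳ k)) ⟩
      ∑ n (λ k → k * r * t (k * r))          ≡⟨ ∑-cong n (λ {k} _ _ →
                                                  trans (*-assoc k r _) (cong (k *_) (*-comm r _))) ⟩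
      ∑ n (λ k → k * (t (k * r) * r))        ∎

    -- Both sides are ∑ k * t k minus the sum over the multiples of r.
    unmarked : ∑ n (λ k → k * unless (r ∣? k) (t k)) ≡ ∑ n (λ k → k * (t k % r))
    unmarked = +-cancelʳ-≡ (∑ n (λ k → k * (t (k * r) * r))) _ _ (begin
      ∑ n (λ k → k * unless (r ∣? k) (t k)) + ∑ n (λ k → k * (t (k * r) * r))       ≡⟨ cong (∑ n (λ k → k * unless (r ∣? k) (t k)) +_) multiples ⟨
      ∑ n (λ k → k * unless (r ∣? k) (t k)) + ∑ n (λ k → k * when (r ∣? k) (t k))   ≡⟨ ∑-+ n _ _ ⟨
      ∑ n (λ k → k * unless (r ∣? k) (t k) + k * when (r ∣? k) (t k))               ≡⟨ ∑-cong n (λ {k} _ _ → regroup k) ⟩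
      ∑ n (λ k → k * (t k % r) + k * (t (k * r) * r))                               ≡⟨ ∑-+ n _ _ ⟩
      ∑ n (λ k → k * (t k % r)) + ∑ n (λ k → k * (t (k * r) * r))                   ∎)
      where
      regroup : ∀ k → k * unless (r ∣? k) (t k) + k * when (r ∣? k) (t k) ≡
                      k * (t k % r) + k * (t (k * r) * r)
      regroup k = begin
        k * unless (r ∣? k) (t k) + k * when (r ∣? k) (t k)  ≡⟨ *-distribˡ-+ k _ _ ⟨
        k * (unless (r ∣? k) (t k) + when (r ∣? k) (t k))    ≡⟨ cong (k *_) (unless+when (r ∣? k) (t k)) ⟩
        k * t k                                              ≡⟨ cong (k *_) (t-digit k) ⟩
        k * (t k % r + t (k * r) * r)                        ≡⟨ *-distribˡ-+ k _ _ ⟩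
        k * (t k % r) + k * (t (k * r) * r)                  ∎

  -- Matched partitions lie in `𝒪ᵤ` and `𝒟ᵤ`

  Matched⇒𝒪ᵤ : ∀ {p q} → Matched p q → 𝒪ᵤ u n r p
  Matched⇒𝒪ᵤ {p} M = (p-parts , (j * r , (multiplicity>0⇒∈ p (subst (0 <_) (sym jr-mult) u≥1) , n∣m*n j) , uniq)) , jr-mult
    where
    open Matched M
    jr-mult : multiplicity (j * r) p ≡ u
    jr-mult = trans (p-mult (j * r))
      (cong₂ _+_ (unless-yes (r ∣? j * r) (n∣m*n j)) (when-yes (j * r ≟ j * r) refl))
    uniq : ∀ {w} → w ∈ p × r ∣ w → j * r ≡ w
    uniq {w} (w∈p , r∣w) with w ≟ j * r
    ... | yes w≡jr = sym w≡jr
    -- At a multiple of `r` other than `j * r` both summands of `𝒪-multiplicity` vanish.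
    ... | no  w≢jr = contradiction (trans (p-mult w)
      (cong₂ _+_ (unless-yes (r ∣? w) r∣w) (when-no (w ≟ j * r) w≢jr))) (>⇒≢ (∈⇒multiplicity>0 w∈p))

  Matched⇒𝒟ᵤ : ∀ {p q} → Matched p q → 𝒟ᵤ u n r q
  Matched⇒𝒟ᵤ {p} {q} M =
    (q-parts , (u , (multiplicity>0⇒∈ q (≤-trans (<⇒≤ r≥2) r≤u-mult) , r≤u-mult) , uniq)) , refl
    where
    open Matched M
    1≤j : 1 ≤ j
    -- If `j` were 0, the part 0 would occur `u` times in `p`.
    1≤j = n≢0⇒n>0 λ j≡0 → >⇒≢ u≥1 (begin
      u                      ≡⟨ when-yes (0 ≟ j * r) (cong (_* r) (sym j≡0)) ⟨
      when (0 ≟ j * r) u     ≡⟨ cong (_+ when (0 ≟ j * r) u) (unless-yes (r ∣? 0) (r ∣0)) ⟨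
      𝒪-multiplicity t j 0   ≡⟨ p-mult 0 ⟨
      multiplicity 0 p       ≡⟨ multiplicity-zero p-parts ⟩
      0                      ∎)
      where open ≡-Reasoning
    r≤u-mult : r ≤ multiplicity u q
    r≤u-mult = begin
      r                   ≤⟨ m≤n*m r j {{>-nonZero 1≤j}} ⟩
      j * r               ≤⟨ m≤n+m (j * r) (t u % r) ⟩
      t u % r + j * r     ≡⟨ u-mult ⟨
      multiplicity u q    ∎
      where open ≤-Reasoning
    uniq : ∀ {w} → w ∈ q × r ≤ multiplicity w q → u ≡ w
    uniq {w} (_ , r≤w-mult) with w ≟ u
    ... | yes w≡u = sym w≡u
    -- Away from `u` the multiplicity is a remainder modulo `r`, hence below `r`.
    ... | no  w≢u = contradiction r≤w-mult (<⇒≱ (subst (_< r) (sym (trans (q-mult w)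
      (trans (cong (t w % r +_) (when-no (w ≟ u) w≢u)) (+-identityʳ _)))) (m%n<n (t w) r)))

  -- Existence of partners, given `t` and `j`

  match-𝒟 : ∀ {t j p} → Merging t → 1 ≤ j → j * r ≤ n → u ≤ n → p PartitionOf n →
            (∀ k → multiplicity k p ≡ 𝒪-multiplicity t j k) → ∃ (Matched p)
  match-𝒟 {t} {j} {p} merging 1≤j jr≤n u≤n h p-mult = fromMultiplicity n m , record
    { t = t ; j = j ; merging = merging ; p-parts = h
    ; q-parts = mkPartition (fromMultiplicity-nonIncreasing n m) (fromMultiplicity-positive n m) (begin
        sum (fromMultiplicity n m)              ≡⟨ sum-fromMultiplicity n m ⟩
        ∑ n (λ k → k * m k)                     ≡⟨ 𝒪-sum≡𝒟-sum merging 1≤j jr≤n u≤n ⟨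
        ∑ n (λ k → k * 𝒪-multiplicity t j k)    ≡⟨ ∑-cong n (λ {k} _ _ → cong (k *_) (p-mult k)) ⟨
        ∑ n (λ k → k * multiplicity k p)        ≡⟨ sum-via-multiplicity h ⟩
        n                                       ∎)
    ; p-mult = p-mult
    -- As `1 ≤ u ≤ n`, the marked summand vanishes at 0 and beyond `n`.
    ; q-mult = multiplicity-fromMultiplicity n m (vanish t-zero (<⇒≢ u≥1))
        (λ n<k → vanish (t-large n<k) λ k≡u → <⇒≱ n<k (subst (_≤ n) (sym k≡u) u≤n))
    }
    where
    open ≡-Reasoning
    open Merging merging
    m = 𝒟-multiplicity t j
    vanish : ∀ {k} → t k ≡ 0 → k ≢ u → m k ≡ 0
    vanish {k} t≡0 k≢u = cong₂ _+_ (trans (cong (_% r) t≡0) (m<n⇒m%n≡m (<⇒≤ r≥2))) (when-no (k ≟ u) k≢u)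

  match-𝒪 : ∀ {t j q} → Merging t → 1 ≤ j → j * r ≤ n → u ≤ n → q PartitionOf n →
            (∀ k → multiplicity k q ≡ 𝒟-multiplicity t j k) → ∃ λ p → Matched p q
  match-𝒪 {t} {j} {q} merging 1≤j jr≤n u≤n h q-mult = fromMultiplicity n m , record
    { t = t ; j = j ; merging = merging ; q-parts = h
    ; p-parts = mkPartition (fromMultiplicity-nonIncreasing n m) (fromMultiplicity-positive n m) (begin
        sum (fromMultiplicity n m)              ≡⟨ sum-fromMultiplicity n m ⟩
        ∑ n (λ k → k * m k)                     ≡⟨ 𝒪-sum≡𝒟-sum merging 1≤j jr≤n u≤n ⟩
        ∑ n (λ k → k * 𝒟-multiplicity t j k)    ≡⟨ ∑-cong n (λ {k} _ _ → cong (k *_) (q-mult k)) ⟨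
        ∑ n (λ k → k * multiplicity k q)        ≡⟨ sum-via-multiplicity h ⟩
        n                                       ∎)
    ; q-mult = q-mult
    ; p-mult = multiplicity-fromMultiplicity n m (vanish t-zero (<⇒≢ (≤-trans 1≤j (m≤m*n j r))))
        (λ n<k → vanish (t-large n<k) λ k≡jr → <⇒≱ n<k (subst (_≤ n) (sym k≡jr) jr≤n))
    }
    where
    open ≡-Reasoning
    open Merging merging
    m = 𝒪-multiplicity t j
    vanish : ∀ {k} → t k ≡ 0 → k ≢ j * r → m k ≡ 0
    vanish {k} t≡0 k≢jr =
      cong₂ _+_ (trans (cong (unless (r ∣? k)) t≡0) (unless-zero (r ∣? k))) (when-no (k ≟ j * r) k≢jr)

  -- Builds `t` from the multiplicities `m` of `p` by well-founded recursion, reading `m` only where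
  -- `r ∤ k`; the marked part is thus left out.
  module Merge (m : ℕ → ℕ) (m-bound : ∀ k → k * m k ≤ n) where

    quotient-< : ∀ i {k} → suc k ≡ i * r → i < suc k
    quotient-< i eq = subst (i <_) (sym eq) (<-* (n≢0⇒n>0 λ { refl → contradiction eq λ () }))

    step : ∀ k → (∀ {i} → i < k → ℕ) → ℕ
    step zero    rec = 0
    step (suc k) rec with r ∣? suc k
    ... | yes (divides i eq) = rec (quotient-< i eq) / r
    ... | no _               = m (suc k)

    -- The extensionality on which the unfolding equation of well-founded recursion rests.
    step-ext : ∀ k {rec rec′ : ∀ {i} → i < k → ℕ} →
               (∀ {i} (i<k : i < k) → rec i<k ≡ rec′ i<k) → step k rec ≡ step k rec′
    step-ext zero    _ = refl
    step-ext (suc k) h with r ∣? suc k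
    ... | yes (divides i eq) = cong (_/ r) (h (quotient-< i eq))
    ... | no _               = refl

    t : ℕ → ℕ
    t = <-rec (λ _ → ℕ) step

    t-unfold : ∀ k → t k ≡ step k (λ {i} _ → t i)
    t-unfold k = WellFounded.FixPoint.unfold-wfRec <-wellFounded (λ _ → ℕ) step step-ext {k}

    t-regular : ∀ {k} → r ∤ k → t k ≡ m k
    t-regular {zero}  r∤k = contradiction (r ∣0) r∤k
    t-regular {suc k} r∤k = trans (t-unfold (suc k)) unfolded
      where
      unfolded : step (suc k) (λ {i} _ → t i) ≡ m (suc k)
      unfolded with r ∣? suc k
      ... | yes r∣k = contradiction r∣k r∤k
      ... | no _    = refl

    t-multiple : ∀ i → t (i * r) ≡ t i / r
    t-multiple i = trans (t-unfold (i * r)) (unfolded (i * r) refl)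
      where
      -- The index is generalised to `k` so that `step` reduces by cases on it; the quotient then
      -- found is `i` by cancellation.
      unfolded : ∀ k → k ≡ i * r → step k (λ {i} _ → t i) ≡ t i / r
      unfolded zero    eq with refl ← *-cancelʳ-≡ 0 i r eq = sym (0/n≡0 r)
      unfolded (suc k) eq with r ∣? suc k
      ... | yes (divides i′ eq′) = cong (λ x → t x / r) (*-cancelʳ-≡ i′ i r (trans (sym eq′) eq))
      ... | no r∤k               = contradiction (divides i eq) r∤k

    -- Merging can only lose weight, through the discarded remainder. The bound forces `t` to vanish
    -- beyond `n`.
    t-bound : ∀ k → k * t k ≤ n
    t-bound = <-rec _ bound
      where
      open ≤-Reasoning
      bound : ∀ k → (∀ {i} → i < k → i * t i ≤ n) → k * t k ≤ n
      bound zero    _  = z≤n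
      bound (suc k) ih = [ multiple , regular ]′ (toSum (r ∣? suc k))
        where
        regular : r ∤ suc k → suc k * t (suc k) ≤ n
        regular r∤k = subst (λ x → suc k * x ≤ n) (sym (t-regular r∤k)) (m-bound (suc k))
        multiple : r ∣ suc k → suc k * t (suc k) ≤ n
        multiple (divides i eq) = begin
          suc k * t (suc k)    ≡⟨ cong (λ x → x * t x) eq ⟩
          i * r * t (i * r)    ≡⟨ cong (i * r *_) (t-multiple i) ⟩
          i * r * (t i / r)    ≡⟨ trans (*-assoc i r _) (cong (i *_) (*-comm r _)) ⟩
          i * (t i / r * r)    ≤⟨ *-monoʳ-≤ i (m/n*n≤m (t i) r) ⟩
          i * t i              ≤⟨ ih (quotient-< i eq) ⟩
          n                    ∎

    merging : Merging t
    merging = record { t-zero = refl ; t-large = large ; t-* = t-multiple }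
      where
      large : ∀ {k} → n < k → t k ≡ 0
      large {k} n<k with t k | t-bound k
      ... | zero  | _ = refl
      ... | suc c | b = contradiction (≤-trans (m≤m*n k (suc c)) b) (<⇒≱ n<k)

  -- Rebuilds `t` from its digits: `s k` is to be `t k % r`, and `s-large` makes each expansion
  -- finite.
  module Unmerge (s : ℕ → ℕ) (s-zero : s 0 ≡ 0) (s-large : ∀ {k} → n < k → s k ≡ 0) (s<r : ∀ k → s k < r) where

    -- The first argument bounds the number of digits s k, s (k * r), s (k * r * r), … used.
    expand : ℕ → ℕ → ℕ
    expand zero    k = 0
    expand (suc f) k = s k + expand f (k * r) * r

    expand-zero : ∀ f → expand f 0 ≡ 0
    expand-zero zero    = refl
    expand-zero (suc f) = cong₂ (λ x y → x + y * r) s-zero (expand-zero f)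

    expand-large : ∀ f {k} → n < k → expand f k ≡ 0
    expand-large zero        _   = refl
    expand-large (suc f) {k} n<k =
      cong₂ (λ x y → x + y * r) (s-large n<k) (expand-large f (<-≤-trans n<k (m≤m*n k r)))

    -- Each multiplication by `r` raises a positive index by at least one, so after `f` digits the
    -- index exceeds `n` and a further digit is 0.
    expand-stable : ∀ f {k} → 1 ≤ k → n < k + f → expand f k ≡ expand (suc f) k
    expand-stable zero    {k} _   n<k = sym (expand-large 1 (subst (n <_) (+-identityʳ k) n<k))
    expand-stable (suc f) {k} 1≤k n<k+f = cong (λ x → s k + x * r)
      (expand-stable f (≤-trans 1≤k (m≤m*n k r))
        (≤-trans n<k+f (≤-trans (≤-reflexive (+-suc k f)) (+-monoˡ-≤ f (<-* 1≤k)))))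

    t : ℕ → ℕ
    t = expand n

    t-expand : ∀ k → t k ≡ s k + t (k * r) * r
    t-expand zero    = trans (expand-zero n) (sym (cong₂ (λ x y → x + y * r) s-zero (expand-zero n)))
    -- `expand (suc n)` unfolds by definition to the right-hand side.
    t-expand (suc k) = expand-stable n (s≤s z≤n) (s≤s (m≤n+m n k))

    t-% : ∀ k → t k % r ≡ s k
    t-% k = trans (cong (_% r) (t-expand k)) (digit-% (s k) (t (k * r)) (s<r k))

    merging : Merging t
    merging = record
      { t-zero  = expand-zero n
      ; t-large = expand-large n
      ; t-*     = λ k → sym (trans (cong (_/ r) (t-expand k)) (digit-/ (s k) (t (k * r)) (s<r k)))
      }

  -- Every partition in `𝒪ᵤ` or `𝒟ᵤ` has a partner

  𝒪ᵤ⇒Matched : ∀ {p} → 𝒪ᵤ u n r p → ∃ (Matched p)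
  𝒪ᵤ⇒Matched {p} ((h , (_ , (v∈p , divides j refl) , uniq)) , v-mult) =
    -- Both `j * r ≤ n` and `u ≤ n` come from the weight `j * r * u` of the marked parts.
    match-𝒟 merging 1≤j (≤-trans (m≤m*n (j * r) u {{>-nonZero u≥1}}) jru≤n)
      (≤-trans (m≤n*m u (j * r) {{>-nonZero (≤-trans 1≤j (m≤m*n j r))}}) jru≤n) h p-mult
    where
    open Merge (flip multiplicity p) (λ k → multiplicity-bound k h)
    1≤j : 1 ≤ j
    1≤j = n≢0⇒n>0 λ { refl → contradiction (All.lookup (positive h) v∈p) λ () }
    jru≤n : j * r * u ≤ n
    jru≤n = subst (λ x → j * r * x ≤ n) v-mult (multiplicity-bound (j * r) h)
    p-mult : ∀ k → multiplicity k p ≡ 𝒪-multiplicity t j k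
    p-mult k with r ∣? k | k ≟ j * r
    ... | yes _   | yes refl = v-mult
    ... | no r∤k  | yes refl = contradiction (n∣m*n j) r∤k
    ... | no r∤k  | no _     = trans (sym (t-regular r∤k)) (sym (+-identityʳ _))
    ... | yes r∣k | no k≢jr  with multiplicity k p in eq
    ...   | zero  = refl
    ...   | suc _ = contradiction
      (sym (uniq (multiplicity>0⇒∈ p (subst (0 <_) (sym eq) (s≤s z≤n)) , r∣k))) k≢jr

  𝒟ᵤ⇒Matched : ∀ {q} → 𝒟ᵤ u n r q → ∃ λ p → Matched p q
  𝒟ᵤ⇒Matched {q} ((h , (_ , (_ , r≤u-mult) , uniq)) , refl) =
    -- Here `j` is `multiplicity u q / r`, positive because `u` occurs at least `r` times.
    match-𝒪 merging (m≥n⇒m/n>0 r≤u-mult)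
      (≤-trans (m/n*n≤m (multiplicity u q) r)
        (≤-trans (m≤n*m (multiplicity u q) u {{>-nonZero u≥1}}) (multiplicity-bound u h)))
      (≤-trans (m≤m*n u (multiplicity u q) {{>-nonZero (≤-trans (<⇒≤ r≥2) r≤u-mult)}}) (multiplicity-bound u h))
      h q-mult
    where
    0%r : ∀ {x} → x ≡ 0 → x % r ≡ 0
    0%r refl = m<n⇒m%n≡m (<⇒≤ r≥2)
    open Unmerge (λ k → multiplicity k q % r) (0%r (multiplicity-zero h))
      (λ n<k → 0%r (multiplicity-large h n<k)) (λ k → m%n<n (multiplicity k q) r)
    q-mult : ∀ k → multiplicity k q ≡ 𝒟-multiplicity t (multiplicity u q / r) k
    q-mult k with k ≟ u
    ... | yes refl = trans (m≡m%n+[m/n]*n (multiplicity u q) r)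
                           (cong (_+ multiplicity u q / r * r) (sym (t-% u)))
    -- By uniqueness `k` occurs fewer than `r` times, so its multiplicity is its own remainder.
    ... | no k≢u   = trans (sym (m<n⇒m%n≡m (≰⇒> λ r≤ →
                             k≢u (sym (uniq (multiplicity>0⇒∈ q (≤-trans (<⇒≤ r≥2) r≤) , r≤))))))
                           (trans (sym (t-% k)) (sym (+-identityʳ _)))

-- Equality of the two counts

∈-filter-partitions : ∀ {n p} {P : List ℕ → Set} (P? : ∀ p → Dec (P p)) → p PartitionOf n → P p →
                      p ∈ filter P? (partitions n)
∈-filter-partitions {n} {p} P? h = ∈-filter⁺ P? (Equivalence.from (∈-partitions n p) h)

theorem1 : (u r : ℕ) → u ≥ 1 → r ≥ 2 → (n : ℕ) → α u r n ≡ β u r n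
theorem1 u r u≥1 r≥2 n = ≤-antisym
  (length-≤-via (Matched u r n u≥1 r≥2) (Matched-injective u r n u≥1 r≥2) _
    (Unique.filter⁺ (𝒪ᵤ? u n r) (partitions-unique n)) λ p∈ →
      let q , M = 𝒪ᵤ⇒Matched u r n u≥1 r≥2 (proj₂ (∈-filter⁻ (𝒪ᵤ? u n r) {xs = partitions n} p∈))
      in  q , ∈-filter-partitions (𝒟ᵤ? u n r) (Matched.q-parts M) (Matched⇒𝒟ᵤ u r n u≥1 r≥2 M) , M)
  (length-≤-via (flip (Matched u r n u≥1 r≥2)) (Matched-functional u r n u≥1 r≥2) _
    (Unique.filter⁺ (𝒟ᵤ? u n r) (partitions-unique n)) λ q∈ →
      let p , M = 𝒟ᵤ⇒Matched u r n u≥1 r≥2 (proj₂ (∈-filter⁻ (𝒟ᵤ? u n r) {xs = partitions n} q∈))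
      in  p , ∈-filter-partitions (𝒪ᵤ? u n r) (Matched.p-parts M) (Matched⇒𝒪ᵤ u r n u≥1 r≥2 M) , M)
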